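{- Let $G,H$ be $\mathsf{K}$-formulae in negation normal form, $\mathfrak{A}_{G,H}$ the formula automaton with global axiom, with state set $Q_{G,H}$, $Q_0$ the set of its states without successors, and $\triangleright$ the derivation relation of the emptiness test for $\mathfrak{A}_{G,H}$. Let $\mathcal{S}_0$ be the set of axioms of the inverse calculus $\mathsf{IC}^{ax}_{G,H}$ and $\vdash_{ax}$ its derivation relation. Then: 1. Let $Q\subseteq Q_{G,H}$ be a set of states such that $Q_0\triangleright^* Q$. Then there exists a set of sequents $\mathcal{S}$ with $\mathcal{S}_0\vdash_{ax}^*\mathcal{S}$ and $Q\subseteq[\![\mathcal{S}]\!]$. 2. Let $\mathcal{S}$ be a set of sequents such that $\mathcal{S}_0\vdash_{ax}^*\mathcal{S}$. Then there exists a set of states $Q\subseteq Q_{G,H}$ with $Q_0\triangleright^* Q$ and $[\![\mathcal{S}]\!]\subseteq Q$.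
   Context: $\mathsf{K}$-formulae are built from propositional atoms with $\wedge,\vee,\neg,\Box,\Diamond$; a formula is in negation normal form (NNF) if $\neg$ occurs only in front of atoms. $(G,H)$-paths: $\Pi_{G,H}$ is the smallest subset of $\{\epsilon_G,\epsilon_H\}\cdot\{\vee_l,\vee_r,\wedge_l,\wedge_r,\Box,\Diamond\}^*$, with addressed subformulae $(G,H)|_\pi$, such that: $\epsilon_G,\epsilon_H\in\Pi_{G,H}$, $(G,H)|_{\epsilon_G}=G$, $(G,H)|_{\epsilon_H}=H$; if $\pi\in\Pi_{G,H}$ and $(G,H)|_\pi=F_1\wedge F_2$ then $\pi\wedge_l,\pi\wedge_r\in\Pi_{G,H}$, addressing $F_1$, $F_2$ respectively ($\pi$ is a $\wedge$-path); if $(G,H)|_\pi=F_1\vee F_2$ then $\pi\vee_l,\pi\vee_r\in\Pi_{G,H}$, addressing $F_1$, $F_2$ respectively ($\vee$-path); if $(G,H)|_\pi=\Box F$ then $\pi\Box\in\Pi_{G,H}$ addresses $F$ ($\Box$-path); if $(G,H)|_\pi=\Diamond F$ then $\pi\Diamond\in\Pi_{G,H}$ addresses $F$ ($\Diamond$-path). Expansions: $\Phi\subseteq\Pi_{G,H}$ is propositionally expanded (p.e.) iff every $\wedge$-path $\pi\in\Phi$ satisfies $\{\pi\wedge_l,\pi\wedge_r\}\subseteq\Phi$, every $\vee$-path $\pi\in\Phi$ satisfies $\{\pi\vee_l,\pi\vee_r\}\cap\Phi\neq\emptyset$, and, if $\Phi\neq\emptyset$, then $\epsilon_H\in\Phi$.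 $\Phi'$ is an expansion of $\Phi$ if $\Phi\subseteq\Phi'$, $\Phi'$ is p.e., and $\Phi'$ is inclusion-minimal with these properties; $\langle\langle\Phi\rangle\rangle$ is the set of expansions of $\Phi$. $\Phi$ contains a clash iff there are $\pi_1,\pi_2\in\Phi$ with $(G,H)|_{\pi_1}=p$, $(G,H)|_{\pi_2}=\neg p$ for a propositional variable $p$; otherwise it is clash-free. Automaton: an $n$-ary looping tree automaton is $(Q,\Sigma,I,\Delta)$ with finite $Q,\Sigma$, initial states $I\subseteq Q$, and $\Delta\subseteq Q\times\Sigma\times Q^n$; $\Delta(q,\sigma)=\{\mathbf{q}\mid(q,\sigma,\mathbf{q})\in\Delta\}$. Fix an enumeration $\pi_1,\dots,\pi_n$ of the $\Diamond$-paths in $\Pi_{G,H}$. $\mathfrak{A}_{G,H}=(Q_{G,H},\Sigma_{G,H},\langle\langle\{\epsilon_G\}\rangle\rangle,\Delta_{G,H})$ with $Q_{G,H}=\Sigma_{G,H}=\{\Phi\subseteq\Pi_{G,H}\mid\Phi\text{ is p.e.}\}$, where $\Delta_{G,H}$ contains only tuples of the form $(\Phi,\Phi,\dots)$; if $\Phi$ is clash-free then $\Delta_{G,H}(\Phi,\Phi)=\langle\langle\Psi_1\rangle\rangle\times\dots\times\langle\langle\Psi_n\rangle\rangle$ with $\Psi_i=\{\pi_i\Diamond\}\cup\{\pi\Box\mid\pi\in\Phi\text{ is a }\Box\text{ -path}\}$ if $\pi_i\in\Phi$ and $\Psi_i=\emptyset$ otherwise; if $\Phi$ contains a clash then $\Delta_{G,H}(\Phi,\Phi)=\emptyset$.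 Emptiness test: $Q_0=\{q\in Q_{G,H}\mid\forall\sigma.\ \Delta_{G,H}(q,\sigma)=\emptyset\}$. For $P,P'\subseteq Q_{G,H}$, $P\triangleright P'$ iff $P'=P\cup\{q\}$ for some state $q$ such that for all $\sigma$ and all $(q_1,\dots,q_n)\in\Delta_{G,H}(q,\sigma)$ there is $j$ with $q_j\in P$. $\triangleright^*$ is the reflexive-transitive closure. Inverse calculus $\mathsf{IC}^{ax}_{G,H}$: a sequent is a subset of $\Pi_{G,H}$; $\Gamma,\Lambda$ denotes union and $\Gamma,\pi$ denotes $\Gamma\cup\{\pi\}$; for a set $\Gamma$ of $\Box$-paths, $\Gamma\Box=\{\pi\Box\mid\pi\in\Gamma\}$. Axioms are all sequents $\{\pi_1,\pi_2\}$ with $(G,H)|_{\pi_1}=p$, $(G,H)|_{\pi_2}=\neg p$ for some propositional variable $p$; $\mathcal{S}_0$ is the set of axioms. Rules (all paths in $\Pi_{G,H}$): $(\vee)$ from $\Gamma_l,\pi\vee_l$ and $\Gamma_r,\pi\vee_r$ infer $\Gamma_l,\Gamma_r,\pi$; $(\wedge_l)$ from $\Gamma,\pi\wedge_l$ infer $\Gamma,\pi$; $(\wedge_r)$ from $\Gamma,\pi\wedge_r$ infer $\Gamma,\pi$; $(\Diamond)$ from $\Gamma\Box,\pi\Diamond$ infer $\Gamma,\pi$; $(\Diamond^+)$ from $\Gamma\Box$ infer $\Gamma,\pi$ for a $\Diamond$-path $\pi$ (in the last two rules $\Gamma$ consists only of $\Box$-paths); $(ax)$ from $\Gamma,\epsilon_H$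 infer $\Gamma$. $\mathcal{S}\vdash_{ax}\mathcal{T}$ iff $\mathcal{T}=\mathcal{S}\cup\{\Gamma\}$ where $\Gamma$ is the conclusion of an inference with premises in $\mathcal{S}$; $\vdash_{ax}^*$ is the reflexive-transitive closure. Represented states: $[\![\Gamma]\!]=\{\Phi\in Q_{G,H}\mid\Gamma\subseteq\Phi\}$ and $[\![\mathcal{S}]\!]=\bigcup_{\Gamma\in\mathcal{S}}[\![\Gamma]\!]$.
   Formalization: Part 2 is proved for nonempty states only: every nonempty state in [[S]] lies in Q. As stated it fails: for H = p ∧ ¬p the empty sequent is derivable and represents the empty state, which is never in a Q with Q_0 ▷* Q. -}

module Defs where

open import Level using (0ℓ) renaming (suc to lsuc)
open import Data.Bool using (Bool; T; if_then_else_)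
open import Data.Fin using (Fin)
open import Data.Nat using (ℕ)
open import Data.Product using (Σ; ∃-syntax; _×_; _,_; proj₁)
open import Data.Sum using (_⊎_)
open import Data.Vec.Functional using (Vector)
open import Function.Bundles using (_⤖_; Bijection)
open import Relation.Binary using (Rel; Setoid)
open import Relation.Binary.Construct.Closure.ReflexiveTransitive using (Star)
open import Relation.Binary.PropositionalEquality using (_≡_)
open import Relation.Nullary using (¬_)
open import Relation.Unary
  using (Pred; _∈_; _⊆_; _≐_; _∪_; ｛_｝; ∅; Satisfiable)
open import Relation.Unary.Properties using (≐-refl; ≐-sym; ≐-trans)

infix  8 □_ ◇_ ~_
infixr 7 _∧_
infixr 6 _∨_

data Formula : Set where
  atom    : ℕ → Formula
  ~_      : Formula → Formula
  _∧_ _∨_ : Formula → Formula → Formula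
  □_ ◇_   : Formula → Formula

data NNF : Formula → Set where
  atom  : ∀ p → NNF (atom p)
  ~atom : ∀ p → NNF (~ atom p)
  _∧_   : ∀ {F₁ F₂} → NNF F₁ → NNF F₂ → NNF (F₁ ∧ F₂)
  _∨_   : ∀ {F₁ F₂} → NNF F₁ → NNF F₂ → NNF (F₁ ∨ F₂)
  □_    : ∀ {F} → NNF F → NNF (□ F)
  ◇_    : ∀ {F} → NNF F → NNF (◇ F)

-- States and letters form setoids because, without function extensionality,
-- sets of paths are compared by their elements.  Neither Q₀ nor ▷ refers to
-- the finiteness of the two sets, so it is not a field.
record LoopingTreeAutomaton (n : ℕ) : Set₁ where
  field
    states   : Setoid 0ℓ 0ℓ
    alphabet : Setoid 0ℓ 0ℓ

  open Setoid states public using () renaming (Carrier to State; _≈_ to _≈ₛ_)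
  open Setoid alphabet public using () renaming (Carrier to Letter)

  field
    Initial : Pred State 0ℓ
    Δ       : State → Letter → Pred (Vector State n) 0ℓ

module EmptinessTest {n : ℕ} (𝔄 : LoopingTreeAutomaton n) where
  open LoopingTreeAutomaton 𝔄

  Q₀ : Pred State 0ℓ
  Q₀ q = ∀ σ qs → ¬ (qs ∈ Δ q σ)

  infix 4 _▷_ _▷*_

  _▷_ : Rel (Pred State 0ℓ) 0ℓ
  P ▷ P′ = ∃[ q ] (∀ σ qs → qs ∈ Δ q σ → ∃[ j ] qs j ∈ P)
                × P′ ≐ P ∪ (q ≈ₛ_)

  _▷*_ : Rel (Pred State 0ℓ) (lsuc 0ℓ)
  _▷*_ = Star _▷_

module PathCalculus (G H : Formula) where

  infixl 9 _·∧ₗ _·∧ᵣ _·∨ₗ _·∨ᵣ _·□ _·◇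

  -- Path F is the set of (G,H)-paths addressing the subformula occurrence F.
  data Path : Formula → Set where
    εG   : Path G
    εH   : Path H
    _·∧ₗ : ∀ {F₁ F₂} → Path (F₁ ∧ F₂) → Path F₁
    _·∧ᵣ : ∀ {F₁ F₂} → Path (F₁ ∧ F₂) → Path F₂
    _·∨ₗ : ∀ {F₁ F₂} → Path (F₁ ∨ F₂) → Path F₁
    _·∨ᵣ : ∀ {F₁ F₂} → Path (F₁ ∨ F₂) → Path F₂
    _·□  : ∀ {F} → Path (□ F) → Path F
    _·◇  : ∀ {F} → Path (◇ F) → Path F

  -- An element of Π is a path together with the formula it addresses.
  Π : Set
  Π = Σ Formula Path

  ◇Path : Set
  ◇Path = ∃[ F ] Path (◇ F)

  -- Subsets of the finite set Π are given by characteristic functions, so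
  -- that, as classically, membership in them is decidable.
  PathSet : Set
  PathSet = Π → Bool

  ⌊_⌋ : PathSet → Pred Π 0ℓ
  ⌊ Φ ⌋ π = T (Φ π)

  infix 4 _∈ₚ_ _≈ₚ_

  _∈ₚ_ : ∀ {F} → Path F → PathSet → Set
  π ∈ₚ Φ = (_ , π) ∈ ⌊ Φ ⌋

  _≈ₚ_ : Rel PathSet 0ℓ
  Φ ≈ₚ Φ′ = ⌊ Φ ⌋ ≐ ⌊ Φ′ ⌋

  record PropExpanded (Φ : PathSet) : Set where
    field
      ∧-closed : ∀ {F₁ F₂} (π : Path (F₁ ∧ F₂)) → π ∈ₚ Φ →
                 (π ·∧ₗ) ∈ₚ Φ × (π ·∧ᵣ) ∈ₚ Φ
      ∨-closed : ∀ {F₁ F₂} (π : Path (F₁ ∨ F₂)) → π ∈ₚ Φ →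
                 (π ·∨ₗ) ∈ₚ Φ ⊎ (π ·∨ᵣ) ∈ₚ Φ
      axiom    : Satisfiable ⌊ Φ ⌋ → εH ∈ₚ Φ

  record _IsExpansionOf_ (Φ′ : PathSet) (Φ : Pred Π 0ℓ) : Set where
    field
      extends  : Φ ⊆ ⌊ Φ′ ⌋
      expanded : PropExpanded Φ′
      minimal  : ∀ Φ″ → Φ ⊆ ⌊ Φ″ ⌋ → PropExpanded Φ″ →
                 ⌊ Φ″ ⌋ ⊆ ⌊ Φ′ ⌋ → ⌊ Φ′ ⌋ ⊆ ⌊ Φ″ ⌋

  ⟨⟨_⟩⟩ : Pred Π 0ℓ → Pred PathSet 0ℓ
  ⟨⟨ Φ ⟩⟩ Φ′ = Φ′ IsExpansionOf Φ

  HasClash : PathSet → Set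
  HasClash Φ = ∃[ p ] Σ (Path (atom p)) λ π₁ → Σ (Path (~ atom p)) λ π₂ →
               π₁ ∈ₚ Φ × π₂ ∈ₚ Φ

  -- { π□ | π ∈ Γ is a □-path }
  data Boxed (Γ : PathSet) : Pred Π 0ℓ where
    boxed : ∀ {F} (π : Path (□ F)) → π ∈ₚ Γ → Boxed Γ (_ , π ·□)

  QGH : Set
  QGH = Σ PathSet PropExpanded

  QGH-setoid : Setoid 0ℓ 0ℓ
  QGH-setoid = record
    { Carrier       = QGH
    ; _≈_           = λ q q′ → proj₁ q ≈ₚ proj₁ q′
    ; isEquivalence = record { refl = ≐-refl ; sym = ≐-sym ; trans = ≐-trans }
    }

  Ψ : ∀ {F} → PathSet → Path (◇ F) → Pred Π 0ℓ
  Ψ Φ πᵢ = if Φ (_ , πᵢ) then ｛ (_ , πᵢ ·◇) ｝ ∪ Boxed Φ else ∅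

  formulaAutomaton : ∀ {n} → Fin n ⤖ ◇Path → LoopingTreeAutomaton n
  formulaAutomaton enum = record
    { states   = QGH-setoid
    ; alphabet = QGH-setoid
    ; Initial  = λ (Φ , _) → Φ ∈ ⟨⟨ ｛ (_ , εG) ｝ ⟩⟩
    ; Δ        = λ (Φ , _) (σ , _) qs →
                   Φ ≈ₚ σ
                 × ¬ HasClash Φ
                 × (∀ i → let (_ , πᵢ) = Bijection.to enum i in
                          proj₁ (qs i) ∈ ⟨⟨ Ψ Φ πᵢ ⟩⟩)
    }

  Sequent : Set
  Sequent = PathSet

  𝒮₀ : Pred Sequent 0ℓ
  𝒮₀ Γ = ∃[ p ] Σ (Path (atom p)) λ π₁ → Σ (Path (~ atom p)) λ π₂ →
         ⌊ Γ ⌋ ≐ ｛ (_ , π₁) ｝ ∪ ｛ (_ , π₂) ｝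

  -- Λ ≈ Γ , π  says that Λ is the sequent Γ ∪ {π}.
  infix 4 _≈_,_

  _≈_,_ : ∀ {F} → Sequent → Pred Π 0ℓ → Path F → Set
  Λ ≈ Γ , π = ⌊ Λ ⌋ ≐ Γ ∪ ｛ (_ , π) ｝

  OnlyBoxPaths : PathSet → Set
  OnlyBoxPaths Γ = ∀ {F} (π : Path F) → π ∈ₚ Γ → ∃[ F′ ] F ≡ □ F′

  -- 𝒮 infers Λ: Λ is the conclusion of an inference whose premises are in 𝒮.
  data _infers_ (𝒮 : Pred Sequent 0ℓ) (Λ : Sequent) : Set where
    ∨-rule  : ∀ {F₁ F₂} (π : Path (F₁ ∨ F₂)) {Γₗ Γᵣ Λₗ Λᵣ} →
              Λₗ ∈ 𝒮 → Λₗ ≈ ⌊ Γₗ ⌋ , π ·∨ₗ →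
              Λᵣ ∈ 𝒮 → Λᵣ ≈ ⌊ Γᵣ ⌋ , π ·∨ᵣ →
              Λ ≈ ⌊ Γₗ ⌋ ∪ ⌊ Γᵣ ⌋ , π →
              𝒮 infers Λ
    ∧ₗ-rule : ∀ {F₁ F₂} (π : Path (F₁ ∧ F₂)) {Γ Λ′} →
              Λ′ ∈ 𝒮 → Λ′ ≈ ⌊ Γ ⌋ , π ·∧ₗ →
              Λ ≈ ⌊ Γ ⌋ , π →
              𝒮 infers Λ
    ∧ᵣ-rule : ∀ {F₁ F₂} (π : Path (F₁ ∧ F₂)) {Γ Λ′} →
              Λ′ ∈ 𝒮 → Λ′ ≈ ⌊ Γ ⌋ , π ·∧ᵣ →
              Λ ≈ ⌊ Γ ⌋ , π →
              𝒮 infers Λ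
    ◇-rule  : ∀ {F} (π : Path (◇ F)) {Γ Λ′} → OnlyBoxPaths Γ →
              Λ′ ∈ 𝒮 → Λ′ ≈ Boxed Γ , π ·◇ →
              Λ ≈ ⌊ Γ ⌋ , π →
              𝒮 infers Λ
    ◇⁺-rule : ∀ {F} (π : Path (◇ F)) {Γ Λ′} → OnlyBoxPaths Γ →
              Λ′ ∈ 𝒮 → ⌊ Λ′ ⌋ ≐ Boxed Γ →
              Λ ≈ ⌊ Γ ⌋ , π →
              𝒮 infers Λ
    ax-rule : ∀ {Λ′} →
              Λ′ ∈ 𝒮 → Λ′ ≈ ⌊ Λ ⌋ , εH →
              𝒮 infers Λ

  infix 4 _⊢ax_ _⊢ax*_

  _⊢ax_ : Rel (Pred Sequent 0ℓ) 0ℓ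
  𝒮 ⊢ax 𝒯 = ∃[ Γ ] 𝒮 infers Γ × 𝒯 ≐ 𝒮 ∪ (Γ ≈ₚ_)

  _⊢ax*_ : Rel (Pred Sequent 0ℓ) (lsuc 0ℓ)
  _⊢ax*_ = Star _⊢ax_

  ⟦_⟧ : Pred Sequent 0ℓ → Pred QGH 0ℓ
  ⟦ 𝒮 ⟧ (Φ , _) = ∃[ Γ ] Γ ∈ 𝒮 × ⌊ Γ ⌋ ⊆ ⌊ Φ ⌋

  -- The state ∅ is propositionally expanded and has the run that is ∅
  -- everywhere, so it lies in no Q with Q₀ ▷* Q.  But {ε_H}, when derivable
  -- (e.g. H = p ∧ ¬ p), yields the empty sequent by (ax), and that sequent
  -- represents every state, ∅ included.
  NonEmpty : Pred QGH 0ℓ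
  NonEmpty (Φ , _) = Satisfiable ⌊ Φ ⌋

{-# OPTIONS --safe #-}
module Submission where

-- Part 1 is tableau saturation.  Repair the defects of a set X of paths one by
-- one by adding the missing subpaths, branching at ∨.  Either some branch ends
-- in an expanded superset of X not represented by 𝒮, hence in an unrepresented
-- expansion of X, or the ∨-, ∧- and ax-rules, read backwards along the branches,
-- derive a sequent included in X.  When ▷ adds a clash-free Φ, the first
-- alternative cannot hold for all Ψᵢ, as it would give a successor tuple of Φ
-- outside P; for some i a sequent included in Ψᵢ is thus derivable, and ◇ or ◇⁺
-- turns it into one included in Φ.
--
-- In part 2 a nonempty expanded set containing the conclusion of a ∨-, ∧- or
-- ax-inference already contains a premise.  For ◇ and ◇⁺ every state containing
-- the conclusion has all its successors for that ◇-path containing the premise,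
-- so ▷ may add these states one by one.

open import Level using (Level; 0ℓ)
open import Data.Bool using (true; false; T; T?)
open import Data.Bool.Properties using (T-≡)
open import Data.Empty using (⊥-elim)
open import Data.Fin using (Fin; zero; suc)
import Data.Fin.Properties as Fin
open import Data.Fin.Subset as Subset using (Subset; inside; outside; _⊂_)
open import Data.Fin.Subset.Induction using (⊂-wellFounded; ⊃-wellFounded)
open import Data.Fin.Subset.Properties using (anySubset?)
open import Data.List as List using (List; []; _∷_; _++_; length)
import Data.List.Membership.Propositional as Listed
import Data.List.Relation.Binary.Subset.Propositional as Sublist
open import Data.List.Relation.Binary.Subset.Propositional.Properties
  using (xs⊆xs++ys; xs⊆ys++xs)
open import Data.List.Relation.Unary.Any as Any using (here; there)
open import Data.List.Relation.Unary.Any.Properties using (lookup-index)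
open import Data.Maybe using (Maybe; just; nothing)
import Data.Maybe.Properties as Maybe
open import Data.Nat using (ℕ; zero; suc)
import Data.Nat.Properties as ℕ
open import Data.Product using (∃; ∃-syntax; _×_; _,_; proj₁; proj₂; -,_)
open import Data.Sum using (_⊎_; inj₁; inj₂; [_,_]′)
import Data.Sum as Sum
open import Data.Unit using (⊤; tt)
open import Data.Vec using ([]; _∷_; lookup; tabulate)
open import Data.Vec.Properties
  using (lookup∘tabulate; lookup⇒[]=; []=⇒lookup)
open import Function using (_∘_; _∘′_; id; flip)
open import Function.Bundles using (_⤖_; Bijection; Equivalence)
open import Induction.WellFounded using (WellFounded; Acc; acc; module Subrelation)
import Relation.Binary.Construct.On as On
open import Relation.Binary.Construct.Closure.ReflexiveTransitive
  using (ε; _◅_; _◅◅_)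
open import Relation.Binary.PropositionalEquality
  using (_≡_; refl; sym; trans; cong; subst)
open import Relation.Nullary
  using (¬_; Dec; yes; no; contradiction; _×-dec_; _→-dec_; ¬?)
open import Relation.Nullary.Decidable
  using (map′; isYes; toWitness; fromWitness; _⊎-dec_)
open import Relation.Unary
  using (Pred; Decidable; Satisfiable; _∈_; _⊆_; _≐_; _∪_; _∩_; ｛_｝)
open import Relation.Unary.Properties using (≐-refl; ≐-sym; _∪?_)
open import Defs

private variable
  a b : Level

-- Finite case distinction and complementary literals

all-or-some : ∀ {n} {A : Fin n → Set a} {B : Fin n → Set b} →
              (∀ i → A i ⊎ B i) → (∀ i → A i) ⊎ ∃ B
all-or-some {n = zero}  h = inj₁ λ ()
all-or-some {n = suc n} h with h zero | all-or-some (h ∘ suc)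
... | inj₂ b | _             = inj₂ (zero , b)
... | inj₁ _ | inj₂ (i , b)  = inj₂ (suc i , b)
... | inj₁ a | inj₁ as       = inj₁ λ { zero → a ; (suc i) → as i }

-- Partial projections reduce the comparison of two literals to a comparison of numbers.
atomOf : Formula → Maybe ℕ
atomOf (atom p) = just p
atomOf _        = nothing

negatedAtomOf : Formula → Maybe ℕ
negatedAtomOf (~ atom p) = just p
negatedAtomOf _          = nothing

atomOf-just : ∀ {F p} → atomOf F ≡ just p → F ≡ atom p
atomOf-just {atom p} refl = refl

negatedAtomOf-just : ∀ {F p} → negatedAtomOf F ≡ just p → F ≡ ~ atom p
negatedAtomOf-just {~ atom p} refl = refl

Complementary : Formula → Formula → Set
Complementary F₁ F₂ = ∃[ p ] F₁ ≡ atom p × F₂ ≡ ~ atom p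

complementary? : ∀ F₁ F₂ → Dec (Complementary F₁ F₂)
complementary? F₁ F₂ with atomOf F₁ in eq
... | nothing = no λ { (_ , refl , _) → contradiction eq λ () }
... | just p  = map′
  (λ eq′ → p , atomOf-just eq , negatedAtomOf-just eq′)
  (λ { (_ , refl , refl) → eq })
  (Maybe.≡-dec ℕ._≟_ (negatedAtomOf F₂) (just p))

module _ {G H : Formula} where
  open PathCalculus G H

  -- Enumeration of the finite set of paths

  -- Extending a path shrinks the formula it addresses, so recursion on the formula reaches all
  -- extensions of `π`.
  occurrences : ∀ F → Path F → List Π
  proper      : ∀ F → Path F → List Π

  occurrences F π = (F , π) ∷ proper F π

  proper (atom _)  π = []
  proper (~ _)     π = []
  proper (F₁ ∧ F₂) π = occurrences F₁ (π ·∧ₗ) ++ occurrences F₂ (π ·∧ᵣ)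
  proper (F₁ ∨ F₂) π = occurrences F₁ (π ·∨ₗ) ++ occurrences F₂ (π ·∨ᵣ)
  proper (□ F)     π = occurrences F (π ·□)
  proper (◇ F)     π = occurrences F (π ·◇)

  allPaths : List Π
  allPaths = occurrences G εG ++ occurrences H εH

  -- Induction on the path. Speaking of the whole list below `π`, not of `π` alone, lets the
  -- hypothesis cover its one-step extensions.
  occurrences⊆allPaths : ∀ {F} (π : Path F) → occurrences F π Sublist.⊆ allPaths
  occurrences⊆allPaths εG = xs⊆xs++ys _ _
  occurrences⊆allPaths εH = xs⊆ys++xs (occurrences H εH) (occurrences G εG)
  occurrences⊆allPaths (π ·∧ₗ) = occurrences⊆allPaths π ∘ there ∘ xs⊆xs++ys _ _
  occurrences⊆allPaths (_·∧ᵣ {F₁} {F₂} π) =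
    occurrences⊆allPaths π ∘ there ∘
    xs⊆ys++xs (occurrences F₂ (π ·∧ᵣ)) (occurrences F₁ (π ·∧ₗ))
  occurrences⊆allPaths (π ·∨ₗ) = occurrences⊆allPaths π ∘ there ∘ xs⊆xs++ys _ _
  occurrences⊆allPaths (_·∨ᵣ {F₁} {F₂} π) =
    occurrences⊆allPaths π ∘ there ∘
    xs⊆ys++xs (occurrences F₂ (π ·∨ᵣ)) (occurrences F₁ (π ·∨ₗ))
  occurrences⊆allPaths (π ·□) = occurrences⊆allPaths π ∘ there
  occurrences⊆allPaths (π ·◇) = occurrences⊆allPaths π ∘ there

  ∈-allPaths : ∀ x → x Listed.∈ allPaths
  ∈-allPaths (F , π) = occurrences⊆allPaths π (here refl)

  #paths : ℕ
  #paths = length allPaths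

  path : Fin #paths → Π
  path = List.lookup allPaths

  index : Π → Fin #paths
  index x = Any.index (∈-allPaths x)

  path-index : ∀ x → path (index x) ≡ x
  path-index x = sym (lookup-index (∈-allPaths x))

  -- `index` is injective, with left inverse `path`, so comparing positions decides equality of
  -- paths.
  _≟_ : (x y : Π) → Dec (x ≡ y)
  x ≟ y = map′
    (λ eq → trans (sym (path-index x)) (trans (cong path eq) (path-index y)))
    (cong index)
    (index x Fin.≟ index y)

  allΠ? : {P : Pred Π 0ℓ} → Decidable P → Dec (∀ x → P x)
  allΠ? {P} P? = map′
    (λ h x → subst P (path-index x) (h (index x)))
    (λ h i → h (path i))
    (Fin.all? (P? ∘ path))

  anyΠ? : {P : Pred Π 0ℓ} → Decidable P → Dec (Satisfiable P)
  anyΠ? {P} P? = map′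
    (λ (i , p) → path i , p)
    (λ (x , p) → index x , subst P (sym (path-index x)) p)
    (Fin.any? (P? ∘ path))

  all-or-someΠ : {P : Pred Π 0ℓ} {B : Set} → (∀ x → P x ⊎ B) → (∀ x → P x) ⊎ B
  all-or-someΠ {P} h =
    Sum.map (λ all x → subst P (path-index x) (all (index x))) proj₂
            (all-or-some (h ∘ path))

  -- Decidable sets of paths

  infix 4 _⊆?_ _≟_

  _⊆?_ : {P : Pred Π 0ℓ} → Decidable P → ∀ Φ → Dec (P ⊆ ⌊ Φ ⌋)
  P? ⊆? Φ = map′ (λ h {x} → h x) (λ h x → h {x})
                 (allΠ? λ x → P? x →-dec T? (Φ x))

  ∈? : ∀ Φ → Decidable ⌊ Φ ⌋
  ∈? Φ = T? ∘ Φ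

  ⟪_⟫ : {P : Pred Π 0ℓ} → Decidable P → PathSet
  ⟪ P? ⟫ x = isYes (P? x)

  ⟪⟫-≐ : {P : Pred Π 0ℓ} (P? : Decidable P) → ⌊ ⟪ P? ⟫ ⌋ ≐ P
  ⟪⟫-≐ P? = toWitness , fromWitness

  infixl 6 _⊕_ _⊖_

  _⊕_ _⊖_ : ∀ {F} → PathSet → Path F → PathSet
  Γ ⊕ π = ⟪ ∈? Γ ∪? ((_ , π) ≟_) ⟫
  Γ ⊖ π = ⟪ (λ x → ∈? Γ x ×-dec ¬? ((_ , π) ≟ x)) ⟫

  ⊆-⊕ : ∀ {F} Γ (π : Path F) → ⌊ Γ ⌋ ⊆ ⌊ Γ ⊕ π ⌋
  ⊆-⊕ Γ π x∈Γ = fromWitness (inj₁ x∈Γ)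

  ∈-⊕ : ∀ {F} Γ (π : Path F) → π ∈ₚ (Γ ⊕ π)
  ∈-⊕ Γ π = fromWitness (inj₂ refl)

  -- Rules take their premises in the form `Γ , π`. Leaving `π` out of the context puts the context
  -- inside `X` whenever the premise is inside `X ⊕ π`.
  ≈-⊖ : ∀ {F} Γ {π : Path F} → π ∈ₚ Γ → Γ ≈ ⌊ Γ ⊖ π ⌋ , π
  ≈-⊖ Γ {π} π∈Γ = ⇒ , [ proj₁ ∘ toWitness , (λ { refl → π∈Γ }) ]′
    where
    ⇒ : ⌊ Γ ⌋ ⊆ ⌊ Γ ⊖ π ⌋ ∪ ｛ (_ , π) ｝
    ⇒ {x} x∈Γ with (_ , π) ≟ x
    ... | yes eq  = inj₂ eq
    ... | no  neq = inj₁ (fromWitness (x∈Γ , neq))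

  insert-⊆ : ∀ {P Q : Pred Π 0ℓ} {F} {π : Path F} Φ →
             Q ⊆ P ∪ ｛ (_ , π) ｝ → P ⊆ ⌊ Φ ⌋ → π ∈ₚ Φ → Q ⊆ ⌊ Φ ⌋
  insert-⊆ Φ Q⊆ P⊆Φ π∈Φ x∈Q = [ P⊆Φ , (λ { refl → π∈Φ }) ]′ (Q⊆ x∈Q)

  -- Finite codes of sets of paths and strict inclusion

  -- Codes give access to exhaustive search over sets and to well-foundedness of strict inclusion.
  encode : PathSet → Subset #paths
  encode Φ = tabulate (Φ ∘ path)

  decode : Subset #paths → PathSet
  decode s x = lookup s (index x)

  decode-encode : ∀ Φ → decode (encode Φ) ≈ₚ Φ
  decode-encode Φ = subst T (eq _) , subst T (sym (eq _))
    where
    eq : ∀ x → decode (encode Φ) x ≡ Φ x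
    eq x = trans (lookup∘tabulate (Φ ∘ path) (index x)) (cong Φ (path-index x))

  ∈-encode⁺ : ∀ Φ {i} → T (Φ (path i)) → i Subset.∈ encode Φ
  ∈-encode⁺ Φ {i} t =
    lookup⇒[]= i _ (trans (lookup∘tabulate (Φ ∘ path) i) (Equivalence.to T-≡ t))

  ∈-encode⁻ : ∀ Φ {i} → i Subset.∈ encode Φ → T (Φ (path i))
  ∈-encode⁻ Φ {i} i∈ =
    Equivalence.from T-≡ (trans (sym (lookup∘tabulate (Φ ∘ path) i)) ([]=⇒lookup i∈))

  infix 4 _⊊_

  _⊊_ : PathSet → PathSet → Set
  Φ ⊊ Φ′ = ⌊ Φ ⌋ ⊆ ⌊ Φ′ ⌋ × ∃[ x ] x ∈ ⌊ Φ′ ⌋ × ¬ x ∈ ⌊ Φ ⌋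

  encode-⊂ : ∀ {Φ Φ′} → Φ ⊊ Φ′ → encode Φ ⊂ encode Φ′
  encode-⊂ {Φ} {Φ′} (Φ⊆Φ′ , x , x∈Φ′ , x∉Φ) =
    (λ i∈ → ∈-encode⁺ Φ′ (Φ⊆Φ′ (∈-encode⁻ Φ i∈))) ,
    index x ,
    ∈-encode⁺ Φ′ (subst ⌊ Φ′ ⌋ (sym (path-index x)) x∈Φ′) ,
    λ i∈ → x∉Φ (subst ⌊ Φ ⌋ (path-index x) (∈-encode⁻ Φ i∈))

  -- Finiteness of `Π` makes both directions terminate: downwards for shrinking to a minimal
  -- expansion, upwards for saturation.
  ⊊-wellFounded : WellFounded _⊊_
  ⊊-wellFounded =
    Subrelation.wellFounded encode-⊂ (On.wellFounded encode ⊂-wellFounded)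

  ⊋-wellFounded : WellFounded (flip _⊊_)
  ⊋-wellFounded =
    Subrelation.wellFounded encode-⊂ (On.wellFounded encode ⊃-wellFounded)

  ⊊-⊕ : ∀ {F} Φ {π : Path F} → ¬ π ∈ₚ Φ → Φ ⊊ Φ ⊕ π
  ⊊-⊕ Φ {π} π∉Φ = ⊆-⊕ Φ π , _ , ∈-⊕ Φ π , π∉Φ

  -- Propositional expansion

  -- Positive form of the failure of `PropExpanded`: each case shows which path, or which of two,
  -- may be added as a repair, and thereby which rule is read backwards.
  data Defect (Φ : PathSet) : Set where
    ∧ₗ-missing : ∀ {F₁ F₂} (π : Path (F₁ ∧ F₂)) →
                 π ∈ₚ Φ → ¬ (π ·∧ₗ) ∈ₚ Φ → Defect Φ
    ∧ᵣ-missing : ∀ {F₁ F₂} (π : Path (F₁ ∧ F₂)) →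
                 π ∈ₚ Φ → ¬ (π ·∧ᵣ) ∈ₚ Φ → Defect Φ
    ∨-missing  : ∀ {F₁ F₂} (π : Path (F₁ ∨ F₂)) →
                 π ∈ₚ Φ → ¬ (π ·∨ₗ) ∈ₚ Φ → ¬ (π ·∨ᵣ) ∈ₚ Φ → Defect Φ
    εH-missing : Satisfiable ⌊ Φ ⌋ → ¬ εH ∈ₚ Φ → Defect Φ

  defect⇒¬expanded : ∀ {Φ} → Defect Φ → ¬ PropExpanded Φ
  defect⇒¬expanded (∧ₗ-missing π π∈ l∉)    pe = l∉ (proj₁ (PropExpanded.∧-closed pe π π∈))
  defect⇒¬expanded (∧ᵣ-missing π π∈ r∉)    pe = r∉ (proj₂ (PropExpanded.∧-closed pe π π∈))
  defect⇒¬expanded (∨-missing π π∈ l∉ r∉)  pe = [ l∉ , r∉ ]′ (PropExpanded.∨-closed pe π π∈)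
  defect⇒¬expanded (εH-missing x εH∉)      pe = εH∉ (PropExpanded.axiom pe x)

  -- `∧-closed` and `∨-closed` localised at one path, so that a finite search can check them;
  -- `axiom` concerns the whole set and is tested apart.
  ClosedAt : PathSet → Pred Π 0ℓ
  ClosedAt Φ (F₁ ∧ F₂ , π) = π ∈ₚ Φ → (π ·∧ₗ) ∈ₚ Φ × (π ·∧ᵣ) ∈ₚ Φ
  ClosedAt Φ (F₁ ∨ F₂ , π) = π ∈ₚ Φ → (π ·∨ₗ) ∈ₚ Φ ⊎ (π ·∨ᵣ) ∈ₚ Φ
  ClosedAt Φ _             = ⊤

  closedAt-or-defect : ∀ Φ x → ClosedAt Φ x ⊎ Defect Φ
  closedAt-or-defect Φ (F₁ ∧ F₂ , π)
    with ∈? Φ (-, π) | ∈? Φ (-, π ·∧ₗ) | ∈? Φ (-, π ·∧ᵣ)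
  ... | no π∉  | _      | _      = inj₁ λ π∈ → contradiction π∈ π∉
  ... | yes π∈ | no l∉  | _      = inj₂ (∧ₗ-missing π π∈ l∉)
  ... | yes π∈ | yes _  | no r∉  = inj₂ (∧ᵣ-missing π π∈ r∉)
  ... | yes _  | yes l∈ | yes r∈ = inj₁ λ _ → l∈ , r∈
  closedAt-or-defect Φ (F₁ ∨ F₂ , π)
    with ∈? Φ (-, π) | ∈? Φ (-, π ·∨ₗ) | ∈? Φ (-, π ·∨ᵣ)
  ... | no π∉  | _      | _      = inj₁ λ π∈ → contradiction π∈ π∉
  ... | yes _  | yes l∈ | _      = inj₁ λ _ → inj₁ l∈
  ... | yes _  | no _   | yes r∈ = inj₁ λ _ → inj₂ r∈
  ... | yes π∈ | no l∉  | no r∉  = inj₂ (∨-missing π π∈ l∉ r∉)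
  closedAt-or-defect Φ (atom _ , _) = inj₁ tt
  closedAt-or-defect Φ (~ _ , _)    = inj₁ tt
  closedAt-or-defect Φ (□ _ , _)    = inj₁ tt
  closedAt-or-defect Φ (◇ _ , _)    = inj₁ tt

  expanded-or-defect : ∀ Φ → PropExpanded Φ ⊎ Defect Φ
  expanded-or-defect Φ
    with all-or-someΠ (closedAt-or-defect Φ) | anyΠ? (∈? Φ) | ∈? Φ (-, εH)
  ... | inj₂ d      | _      | _       = inj₂ d
  ... | inj₁ _      | yes x  | no εH∉  = inj₂ (εH-missing x εH∉)
  ... | inj₁ closed | no ¬x  | _       = inj₁ record
    { ∧-closed = λ π → closed (-, π)
    ; ∨-closed = λ π → closed (-, π)
    ; axiom    = λ x → contradiction x ¬x
    }
  ... | inj₁ closed | yes _  | yes εH∈ = inj₁ record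
    { ∧-closed = λ π → closed (-, π)
    ; ∨-closed = λ π → closed (-, π)
    ; axiom    = λ _ → εH∈
    }

  expanded? : Decidable PropExpanded
  expanded? Φ = [ yes , no ∘ defect⇒¬expanded ]′ (expanded-or-defect Φ)

  expanded-resp-≈ : ∀ {Φ Φ′} → Φ ≈ₚ Φ′ → PropExpanded Φ → PropExpanded Φ′
  expanded-resp-≈ (⇒ , ⇐) pe = record
    { ∧-closed = λ π π∈ → let (l , r) = ∧-closed π (⇐ π∈) in ⇒ l , ⇒ r
    ; ∨-closed = λ π π∈ → Sum.map ⇒ ⇒ (∨-closed π (⇐ π∈))
    ; axiom    = λ (x , x∈) → ⇒ (axiom (x , ⇐ x∈))
    }
    where open PropExpanded pe

  -- Passing to strictly smaller expanded supersets of `P` must stop. The bound by `Φ` matters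
  -- later: a subset of an unrepresented set is unrepresented.
  minimalExpansion : {P : Pred Π 0ℓ} → Decidable P →
                     ∀ Φ → P ⊆ ⌊ Φ ⌋ → PropExpanded Φ →
                     ∃[ Φ′ ] Φ′ IsExpansionOf P × ⌊ Φ′ ⌋ ⊆ ⌊ Φ ⌋
  minimalExpansion {P} P? Φ = go Φ (⊊-wellFounded Φ)
    where
    go : ∀ Φ → Acc _⊊_ Φ → P ⊆ ⌊ Φ ⌋ → PropExpanded Φ →
         ∃[ Φ′ ] Φ′ IsExpansionOf P × ⌊ Φ′ ⌋ ⊆ ⌊ Φ ⌋
    smaller? : ∀ Φ s → Dec (P ⊆ ⌊ decode s ⌋ × PropExpanded (decode s) × decode s ⊊ Φ)
    smaller? Φ s =
      P? ⊆? decode s ×-dec expanded? (decode s) ×-dec ∈? (decode s) ⊆? Φ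
      ×-dec anyΠ? λ x → ∈? Φ x ×-dec ¬? (∈? (decode s) x)

    go Φ (acc rec) P⊆Φ pe with anySubset? (smaller? Φ)
    ... | yes (s , P⊆s , pe-s , s⊊Φ) =
      let (Φ′ , isExp , Φ′⊆s) = go (decode s) (rec s⊊Φ) P⊆s pe-s
      in Φ′ , isExp , proj₁ s⊊Φ ∘ Φ′⊆s
    ... | no ¬smaller = Φ , record
      { extends  = P⊆Φ
      ; expanded = pe
      ; minimal  = minimal
      } , id
      where
      minimal : ∀ Φ″ → P ⊆ ⌊ Φ″ ⌋ → PropExpanded Φ″ →
                ⌊ Φ″ ⌋ ⊆ ⌊ Φ ⌋ → ⌊ Φ ⌋ ⊆ ⌊ Φ″ ⌋
      minimal Φ″ P⊆Φ″ pe″ Φ″⊆Φ {x} x∈Φ with ∈? Φ″ x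
      ... | yes x∈Φ″ = x∈Φ″
      ... | no  x∉Φ″ =
        -- The failed search ranged over codes only, so `Φ″` is replaced by the decoding of its
        -- code.
        let (⇒ , ⇐) = decode-encode Φ″
        in ⊥-elim (¬smaller (encode Φ″ , (λ {y} → ⇐ {y} ∘ P⊆Φ″)
           , expanded-resp-≈ (≐-sym (decode-encode Φ″)) pe″
           , (λ {y} → Φ″⊆Φ ∘ ⇒ {y}) , x , x∈Φ , x∉Φ″ ∘ ⇒ {x}))

  -- Clashes, boxed paths and modal successor sets

  clash? : Decidable HasClash
  clash? Φ = map′
    (λ { ((_ , π₁) , (_ , π₂) , (p , refl , refl) , π₁∈ , π₂∈) → p , π₁ , π₂ , π₁∈ , π₂∈ })
    (λ { (p , π₁ , π₂ , π₁∈ , π₂∈) → (_ , π₁) , (_ , π₂) , (p , refl , refl) , π₁∈ , π₂∈ })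
    (anyΠ? λ x → anyΠ? λ y →
      complementary? (proj₁ x) (proj₁ y) ×-dec ∈? Φ x ×-dec ∈? Φ y)

  boxed? : ∀ Φ → Decidable (Boxed Φ)
  boxed? Φ (_ , π ·□)  = map′ (boxed π) (λ { (boxed _ π∈) → π∈ }) (∈? Φ (-, π))
  boxed? Φ (_ , εG)    = no λ ()
  boxed? Φ (_ , εH)    = no λ ()
  boxed? Φ (_ , π ·∧ₗ) = no λ ()
  boxed? Φ (_ , π ·∧ᵣ) = no λ ()
  boxed? Φ (_ , π ·∨ₗ) = no λ ()
  boxed? Φ (_ , π ·∨ᵣ) = no λ ()
  boxed? Φ (_ , π ·◇)  = no λ ()

  Ψ? : ∀ {F} Φ (π : Path (◇ F)) → Decidable (Ψ Φ π)
  Ψ? Φ π x with Φ (_ , π)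
  ... | true  = ((_ , π ·◇) ≟ x) ⊎-dec boxed? Φ x
  ... | false = no λ ()

  -- `Ψ` reduces only once the value of `Φ` at `π` is known; the case `false` is empty.
  Ψ⁺ : ∀ {F} Φ (π : Path (◇ F)) → π ∈ₚ Φ → ｛ (_ , π ·◇) ｝ ∪ Boxed Φ ⊆ Ψ Φ π
  Ψ⁺ Φ π π∈ h with true ← Φ (_ , π) = h

  Ψ⁻ : ∀ {F} Φ (π : Path (◇ F)) {x} → x ∈ Ψ Φ π →
       π ∈ₚ Φ × x ∈ ｛ (_ , π ·◇) ｝ ∪ Boxed Φ
  Ψ⁻ Φ π h with true ← Φ (_ , π) = tt , h

  -- The largest set of `□`-paths whose boxes all lie in `Γ`: the context of a modal rule read
  -- backwards.
  unbox : PathSet → PathSet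
  unbox Γ (□ F , π) = Γ (F , π ·□)
  unbox Γ _         = false

  unbox-onlyBoxPaths : ∀ Γ → OnlyBoxPaths (unbox Γ)
  unbox-onlyBoxPaths Γ {□ F}    π π∈ = F , refl
  unbox-onlyBoxPaths Γ {atom _} π ()
  unbox-onlyBoxPaths Γ {~ _}    π ()
  unbox-onlyBoxPaths Γ {_ ∧ _}  π ()
  unbox-onlyBoxPaths Γ {_ ∨ _}  π ()
  unbox-onlyBoxPaths Γ {◇ _}    π ()

  boxed-unbox : ∀ Γ → Boxed (unbox Γ) ⊆ ⌊ Γ ⌋
  boxed-unbox Γ (boxed π π∈) = π∈

  unbox-⊆ : ∀ {Γ Φ} → Boxed (unbox Γ) ⊆ Boxed Φ → ⌊ unbox Γ ⌋ ⊆ ⌊ Φ ⌋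
  unbox-⊆ {Γ} {Φ} h {F , π} π∈ with unbox-onlyBoxPaths Γ π π∈
  ... | _ , refl with boxed _ π∈′ ← h (boxed π π∈) = π∈′

  -- Representation and derivability

  -- `⟦_⟧` extended to sets that need not be expanded, as they occur during saturation.
  Represents : Pred Sequent 0ℓ → Pred PathSet 0ℓ
  Represents 𝒮 Φ = ∃[ Γ ] Γ ∈ 𝒮 × ⌊ Γ ⌋ ⊆ ⌊ Φ ⌋

  Represents-mono : ∀ {𝒮 𝒯} → 𝒮 ⊆ 𝒯 → Represents 𝒮 ⊆ Represents 𝒯
  Represents-mono 𝒮⊆𝒯 (Γ , Γ∈ , Γ⊆) = Γ , 𝒮⊆𝒯 Γ∈ , Γ⊆

  Represents-⊆ : ∀ {𝒮 Φ Φ′} → ⌊ Φ ⌋ ⊆ ⌊ Φ′ ⌋ → Represents 𝒮 Φ → Represents 𝒮 Φ′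
  Represents-⊆ Φ⊆Φ′ (Γ , Γ∈ , Γ⊆) = Γ , Γ∈ , Φ⊆Φ′ ∘′ Γ⊆

  clash⇒represented : ∀ {Φ} → HasClash Φ → Represents 𝒮₀ Φ
  clash⇒represented (p , π₁ , π₂ , π₁∈ , π₂∈) =
    ⟪ pair? ⟫ , (p , π₁ , π₂ , ⟪⟫-≐ pair?) ,
    [ (λ { refl → π₁∈ }) , (λ { refl → π₂∈ }) ]′ ∘′ proj₁ (⟪⟫-≐ pair?)
    where pair? = ((_ , π₁) ≟_) ∪? ((_ , π₂) ≟_)

  represented⇒clash : ∀ {Φ} → Represents 𝒮₀ Φ → HasClash Φ
  represented⇒clash (Γ , (p , π₁ , π₂ , _ , ⇐) , Γ⊆Φ) =
    p , π₁ , π₂ , Γ⊆Φ (⇐ (inj₁ refl)) , Γ⊆Φ (⇐ (inj₂ refl))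

  represents-𝒮₀? : Decidable (Represents 𝒮₀)
  represents-𝒮₀? Φ = map′ clash⇒represented represented⇒clash (clash? Φ)

  ⊢*⇒⊆ : ∀ {𝒮 𝒯} → 𝒮 ⊢ax* 𝒯 → 𝒮 ⊆ 𝒯
  ⊢*⇒⊆ ε                           = id
  ⊢*⇒⊆ ((_ , _ , _ , ⇐) ◅ 𝒮₁⊢*𝒯) = ⊢*⇒⊆ 𝒮₁⊢*𝒯 ∘′ ⇐ ∘′ inj₁

  -- Sets of sequents are arbitrary predicates, so decidability of representation is carried along
  -- as an invariant; saturation branches on it.
  Derives : Pred Sequent 0ℓ → PathSet → Set₁
  Derives 𝒮 Φ = ∃[ 𝒯 ] 𝒮 ⊢ax* 𝒯 × Decidable (Represents 𝒯) × Represents 𝒯 Φ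

  derive-trans : ∀ {𝒮 𝒯 Φ} → 𝒮 ⊢ax* 𝒯 → Derives 𝒯 Φ → Derives 𝒮 Φ
  derive-trans 𝒮⊢*𝒯 (𝒰 , 𝒯⊢*𝒰 , rest) = 𝒰 , 𝒮⊢*𝒯 ◅◅ 𝒯⊢*𝒰 , rest

  -- One added sequent keeps representation decidable, since its inclusion in a set is a finite
  -- check.
  infer : ∀ {𝒮 Λ Φ} → Decidable (Represents 𝒮) →
          𝒮 infers Λ → ⌊ Λ ⌋ ⊆ ⌊ Φ ⌋ → Derives 𝒮 Φ
  infer {𝒮} {Λ} dec inf Λ⊆Φ =
    𝒮 ∪ (Λ ≈ₚ_) , (Λ , inf , ≐-refl) ◅ ε , dec′ , Λ , inj₂ ≐-refl , Λ⊆Φ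
    where
    dec′ : Decidable (Represents (𝒮 ∪ (Λ ≈ₚ_)))
    dec′ Φ with dec Φ | ∈? Λ ⊆? Φ
    ... | yes rep | _       = yes (Represents-mono inj₁ rep)
    ... | no _    | yes Λ⊆Φ = yes (Λ , inj₂ ≐-refl , Λ⊆Φ)
    ... | no ¬rep | no Λ⊈Φ  = no λ
      { (Γ , inj₁ Γ∈ , Γ⊆Φ)        → ¬rep (Γ , Γ∈ , Γ⊆Φ)
      ; (Γ , inj₂ (Λ⊆Γ , _) , Γ⊆Φ) → Λ⊈Φ (Γ⊆Φ ∘′ Λ⊆Γ) }

  -- Saturation

  Unrepresented : Pred Sequent 0ℓ → PathSet → Set
  Unrepresented 𝒮 X = ∃[ Φ ] ⌊ X ⌋ ⊆ ⌊ Φ ⌋ × PropExpanded Φ × ¬ Represents 𝒮 Φ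

  Outcome : Pred Sequent 0ℓ → PathSet → Set₁
  Outcome 𝒮 X = Unrepresented 𝒮 X ⊎ Derives 𝒮 X

  -- Evaluates the branch that adds `π`. An unrepresented superset of `X ⊕ π` serves `X` too, and a
  -- derived sequent without `π` already lies in `X`. Only a sequent containing `π` calls for a
  -- rule, which `k` supplies; what `k` finds unrepresented by `𝒯` is so by the smaller `𝒮`.
  discharge : ∀ {𝒮 X F} (π : Path F) → Outcome 𝒮 (X ⊕ π) →
              (∀ {𝒯 Γ Γ′} → 𝒮 ⊆ 𝒯 → Decidable (Represents 𝒯) →
                Γ ∈ 𝒯 → Γ ≈ ⌊ Γ′ ⌋ , π → ⌊ Γ′ ⌋ ⊆ ⌊ X ⌋ → Outcome 𝒯 X) →
              Outcome 𝒮 X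
  discharge {X = X} π (inj₁ (Φ , X⊕π⊆Φ , pe , ¬rep)) k =
    inj₁ (Φ , (λ {x} → X⊕π⊆Φ {x} ∘′ ⊆-⊕ X π {x}) , pe , ¬rep)
  discharge {X = X} π (inj₂ (𝒯 , 𝒮⊢*𝒯 , dec , Γ , Γ∈ , Γ⊆)) k with ∈? Γ (-, π)
  ... | no π∉Γ = inj₂ (𝒯 , 𝒮⊢*𝒯 , dec , Γ , Γ∈ , λ {x} x∈Γ →
          [ id , (λ { refl → contradiction x∈Γ π∉Γ }) ]′ (toWitness (Γ⊆ {x} x∈Γ)))
  ... | yes π∈Γ = Sum.map
          (λ (Φ , X⊆Φ , pe , ¬rep) → Φ , X⊆Φ , pe , ¬rep ∘′ Represents-mono (⊢*⇒⊆ 𝒮⊢*𝒯))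
          (derive-trans 𝒮⊢*𝒯)
          (k (⊢*⇒⊆ 𝒮⊢*𝒯) dec Γ∈ (≈-⊖ Γ π∈Γ) λ {x} x∈Γ⊖π →
             let (x∈Γ , π≢x) = toWitness x∈Γ⊖π
             in [ id , (λ π≡x → contradiction π≡x π≢x) ]′ (toWitness (Γ⊆ {x} x∈Γ)))

  infer-insert : ∀ {𝒮 Φ P F} {π : Path F} → Decidable (Represents 𝒮) → Decidable P →
                 (∀ {Λ} → Λ ≈ P , π → 𝒮 infers Λ) →
                 P ⊆ ⌊ Φ ⌋ → π ∈ₚ Φ → Derives 𝒮 Φ
  infer-insert {Φ = Φ} {π = π} dec P? rule P⊆Φ π∈Φ =
    infer dec (rule Λ≈) (insert-⊆ Φ (proj₁ Λ≈) P⊆Φ π∈Φ)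
    where Λ≈ = ⟪⟫-≐ (P? ∪? ((_ , π) ≟_))

  saturate : ∀ {𝒮} X → Decidable (Represents 𝒮) → Outcome 𝒮 X
  saturate X = go X (⊋-wellFounded X)
    where
    go : ∀ {𝒮} X → Acc (flip _⊊_) X → Decidable (Represents 𝒮) → Outcome 𝒮 X
    go {𝒮} X (acc rec) dec with expanded-or-defect X
    ... | inj₁ pe with dec X
    ...   | yes rep = inj₂ (𝒮 , ε , dec , rep)
    ...   | no ¬rep = inj₁ (X , id , pe , ¬rep)
    go X (acc rec) dec | inj₂ (εH-missing _ εH∉) =
      discharge εH (go (X ⊕ εH) (rec (⊊-⊕ X εH∉)) dec) λ _ dec′ Γ∈ Γ≈ Γ′⊆X →
        inj₂ (infer dec′ (ax-rule Γ∈ Γ≈) Γ′⊆X)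
    go X (acc rec) dec | inj₂ (∧ₗ-missing π π∈ l∉) =
      discharge (π ·∧ₗ) (go (X ⊕ π ·∧ₗ) (rec (⊊-⊕ X l∉)) dec) λ {_} {_} {Γ′} _ dec′ Γ∈ Γ≈ Γ′⊆X →
        inj₂ (infer-insert dec′ (∈? Γ′) (∧ₗ-rule π Γ∈ Γ≈) Γ′⊆X π∈)
    go X (acc rec) dec | inj₂ (∧ᵣ-missing π π∈ r∉) =
      discharge (π ·∧ᵣ) (go (X ⊕ π ·∧ᵣ) (rec (⊊-⊕ X r∉)) dec) λ {_} {_} {Γ′} _ dec′ Γ∈ Γ≈ Γ′⊆X →
        inj₂ (infer-insert dec′ (∈? Γ′) (∧ᵣ-rule π Γ∈ Γ≈) Γ′⊆X π∈)
    go X (acc rec) dec | inj₂ (∨-missing π π∈ l∉ r∉) =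
      discharge (π ·∨ₗ) (go (X ⊕ π ·∨ₗ) (rec (⊊-⊕ X l∉)) dec) λ {_} {_} {Γₗ} _ dec′ l∈ l≈ Γₗ⊆X →
      -- The right branch starts from the sequents derived in the left one, so that both premises
      -- end up in one set.
      discharge (π ·∨ᵣ) (go (X ⊕ π ·∨ᵣ) (rec (⊊-⊕ X r∉)) dec′) λ {_} {_} {Γᵣ} 𝒯⊆ dec″ r∈ r≈ Γᵣ⊆X →
        inj₂ (infer-insert dec″ (∈? Γₗ ∪? ∈? Γᵣ) (∨-rule π (𝒯⊆ l∈) l≈ r∈ r≈)
                           [ Γₗ⊆X , Γᵣ⊆X ]′ π∈)

  -- Modal rules read backwards

  -- A sequent inside `Ψ Φ π` consists of boxed paths of `Φ` and possibly `π ·◇`. The presence of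
  -- `π ·◇` decides between `◇-rule` and `◇⁺-rule`.
  derive-modal : ∀ {𝒮 Φ F} (π : Path (◇ F)) → Derives 𝒮 ⟪ Ψ? Φ π ⟫ → Derives 𝒮 Φ
  derive-modal {Φ = Φ} π (𝒯 , 𝒮⊢*𝒯 , dec , Γ , Γ∈ , Γ⊆Ψ) with ∈? Φ (-, π)
  -- Here `Ψ Φ π` is empty, so `Γ` is the empty sequent and lies in every set.
  ... | no π∉Φ = 𝒯 , 𝒮⊢*𝒯 , dec , Γ , Γ∈ , λ {x} x∈Γ →
          contradiction (proj₁ (Ψ⁻ Φ π (toWitness (Γ⊆Ψ {x} x∈Γ)))) π∉Φ
  ... | yes π∈Φ = derive-trans 𝒮⊢*𝒯 modal
    where
    Γ₀ = unbox Γ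

    Γ⊆ : ⌊ Γ ⌋ ⊆ ｛ (_ , π ·◇) ｝ ∪ Boxed Φ
    Γ⊆ {x} x∈Γ = proj₂ (Ψ⁻ Φ π (toWitness (Γ⊆Ψ {x} x∈Γ)))

    Γ₀⊆Φ : ⌊ Γ₀ ⌋ ⊆ ⌊ Φ ⌋
    Γ₀⊆Φ = unbox-⊆ {Γ} {Φ} λ { (boxed ρ ρ∈) → [ (λ ()) , id ]′ (Γ⊆ {_ , ρ ·□} ρ∈) }

    Γ⇒ : ⌊ Γ ⌋ ⊆ Boxed Γ₀ ∪ ｛ (_ , π ·◇) ｝
    Γ⇒ {x} x∈Γ with Γ⊆ {x} x∈Γ
    ... | inj₁ eq          = inj₂ eq
    ... | inj₂ (boxed ρ _) = inj₁ (boxed ρ x∈Γ)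

    modal : Derives 𝒯 Φ
    modal with ∈? Γ (-, π ·◇)
    ... | yes ◇∈Γ = infer-insert dec (∈? Γ₀)
            (◇-rule π (unbox-onlyBoxPaths Γ) Γ∈
              (Γ⇒ , insert-⊆ Γ id (boxed-unbox Γ) ◇∈Γ))
            Γ₀⊆Φ π∈Φ
    ... | no ◇∉Γ = infer-insert dec (∈? Γ₀)
            (◇⁺-rule π (unbox-onlyBoxPaths Γ) Γ∈
              ((λ {x} x∈Γ → [ id , (λ { refl → contradiction x∈Γ ◇∉Γ }) ]′ (Γ⇒ x∈Γ)) ,
               boxed-unbox Γ))
            Γ₀⊆Φ π∈Φ

  module _ {n} (enum : Fin n ⤖ ◇Path) where
    open LoopingTreeAutomaton (formulaAutomaton enum)
    open EmptinessTest (formulaAutomaton enum)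
    open Bijection enum using (to; strictlySurjective)

    -- From the emptiness test to the calculus

    represent-state : ∀ {𝒮} → 𝒮₀ ⊆ 𝒮 → Decidable (Represents 𝒮) → (q : QGH) →
                      (∀ σ qs → qs ∈ Δ q σ → ∃[ j ] qs j ∈ ⟦ 𝒮 ⟧) →
                      Derives 𝒮 (proj₁ q)
    represent-state {𝒮} 𝒮₀⊆𝒮 dec (Φ , pe) hits with clash? Φ
    ... | yes clash = 𝒮 , ε , dec , Represents-mono 𝒮₀⊆𝒮 (clash⇒represented clash)
    ... | no ¬clash = [ impossible , proj₂ ]′ (all-or-some successor)
      where
      ◇path : ∀ i → Path (◇ (proj₁ (to i)))
      ◇path i = proj₂ (to i)

      successor : ∀ i →
        (∃[ Φ′ ] Φ′ ∈ ⟨⟨ Ψ Φ (◇path i) ⟩⟩ × ¬ Represents 𝒮 Φ′) ⊎ Derives 𝒮 Φ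
      successor i = Sum.map
        (λ (Φ′ , Ψ⊆Φ′ , pe′ , ¬rep) →
          let (Φ″ , isExp , Φ″⊆Φ′) =
                minimalExpansion (Ψ? Φ (◇path i)) Φ′ (λ {x} → Ψ⊆Φ′ {x} ∘′ fromWitness) pe′
          in Φ″ , isExp , ¬rep ∘′ Represents-⊆ Φ″⊆Φ′)
        (derive-modal (◇path i))
        (saturate ⟪ Ψ? Φ (◇path i) ⟫ dec)

      impossible : (∀ i → ∃[ Φ′ ] Φ′ ∈ ⟨⟨ Ψ Φ (◇path i) ⟩⟩ × ¬ Represents 𝒮 Φ′) →
                   Derives 𝒮 Φ
      impossible succ =
        -- A state has transitions only under the letter equal to itself, so `Φ` is read as its own
        -- letter.
        let (j , rep) = hits (Φ , pe)
              (λ i → let (Φ′ , isExp , _) = succ i in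
                     Φ′ , _IsExpansionOf_.expanded isExp)
              (≐-refl , ¬clash , λ i → proj₁ (proj₂ (succ i)))
        in contradiction rep (proj₂ (proj₂ (succ j)))

    -- Generalised from `Q₀` to any `P` already represented. Deriving `𝒮` from `𝒮₀` keeps the axioms
    -- available for states with a clash.
    ▷*⇒⊢* : ∀ {P Q 𝒮} → P ▷* Q → 𝒮₀ ⊢ax* 𝒮 → Decidable (Represents 𝒮) → P ⊆ ⟦ 𝒮 ⟧ →
            ∃[ 𝒯 ] (𝒮₀ ⊢ax* 𝒯 × Q ⊆ ⟦ 𝒯 ⟧)
    ▷*⇒⊢* {𝒮 = 𝒮} ε 𝒮₀⊢*𝒮 _ P⊆𝒮 = 𝒮 , 𝒮₀⊢*𝒮 , P⊆𝒮
    ▷*⇒⊢* ((q , hits , ⇒ , _) ◅ P₁▷*Q) 𝒮₀⊢*𝒮 dec P⊆𝒮 =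
      let (𝒯 , 𝒮⊢*𝒯 , dec′ , rep) =
            represent-state (⊢*⇒⊆ 𝒮₀⊢*𝒮) dec q
              (λ σ qs qs∈ → let (j , qⱼ∈P) = hits σ qs qs∈ in j , P⊆𝒮 qⱼ∈P)
      in ▷*⇒⊢* P₁▷*Q (𝒮₀⊢*𝒮 ◅◅ 𝒮⊢*𝒯) dec′
           λ {q′} q′∈ → [ Represents-mono (⊢*⇒⊆ 𝒮⊢*𝒯) ∘′ P⊆𝒮
                        , (λ (q⊆q′ , _) → Represents-⊆ {Φ′ = proj₁ q′} q⊆q′ rep)
                        ]′ (⇒ q′∈)

    -- A clash-free state always has successors: the set of all paths is expanded and shrinks to an
    -- expansion of each `Ψ Φ πᵢ`.
    Q₀⊆⟦𝒮₀⟧ : Q₀ ⊆ ⟦ 𝒮₀ ⟧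
    Q₀⊆⟦𝒮₀⟧ {Φ , pe} q∈Q₀ with clash? Φ
    ... | yes clash = clash⇒represented clash
    ... | no ¬clash = contradiction (≐-refl , ¬clash , λ i → proj₁ (proj₂ (successor i)))
          (q∈Q₀ (Φ , pe) λ i → let (Φ′ , isExp , _) = successor i in
                               Φ′ , _IsExpansionOf_.expanded isExp)
      where
      full-expanded : PropExpanded (λ _ → true)
      full-expanded = record { ∧-closed = _ ; ∨-closed = λ _ _ → inj₁ tt ; axiom = _ }

      successor : ∀ i → let (_ , πᵢ) = to i in
                  ∃[ Φ′ ] Φ′ IsExpansionOf Ψ Φ πᵢ × ⌊ Φ′ ⌋ ⊆ (λ _ → ⊤)
      successor i = let (_ , πᵢ) = to i in
        minimalExpansion (Ψ? Φ πᵢ) (λ _ → true) _ full-expanded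

    -- From the calculus to the emptiness test

    Addable : Pred State 0ℓ → Pred Sequent 0ℓ
    Addable P Λ = ∀ q → ⌊ Λ ⌋ ⊆ ⌊ proj₁ q ⌋ →
                  ∀ σ qs → qs ∈ Δ q σ → ∃[ j ] qs j ∈ P

    ▷*⇒⊆ : ∀ {P Q} → P ▷* Q → P ⊆ Q
    ▷*⇒⊆ ε                          = id
    ▷*⇒⊆ ((_ , _ , _ , ⇐) ◅ P₁▷*Q) = ▷*⇒⊆ P₁▷*Q ∘′ ⇐ ∘′ inj₁

    -- Used with f = decode, where k is the number of paths; a general f lets
    -- the recursion on k fix one path after the other.
    add-states : ∀ Λ {k} (f : Subset k → PathSet) {P P₁} →
                 Addable P Λ → P ⊆ P₁ →
                 ∃[ P′ ] (P₁ ▷* P′ ×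
                   (∀ q s → proj₁ q ≈ₚ f s → ⌊ Λ ⌋ ⊆ ⌊ proj₁ q ⌋ → q ∈ P′))
    add-states Λ {zero} f {P₁ = P₁} addable P⊆P₁
      with expanded? (f []) | ∈? Λ ⊆? f []
    ... | yes pe | yes Λ⊆ =
      P₁ ∪ ((f [] , pe) ≈ₛ_) ,
      ((f [] , pe) ,
       (λ σ qs qs∈ → let (j , qⱼ∈P) = addable (f [] , pe) Λ⊆ σ qs qs∈ in j , P⊆P₁ qⱼ∈P) ,
       ≐-refl) ◅ ε ,
      λ { q [] q≈ _ → inj₂ (≐-sym q≈) }
    ... | no ¬pe | _ = P₁ , ε ,
      λ { (_ , pe) [] q≈ _ → contradiction (expanded-resp-≈ q≈ pe) ¬pe }
    ... | yes _ | no Λ⊈ = P₁ , ε ,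
      λ { q [] q≈ Λ⊆q → ⊥-elim (Λ⊈ (proj₁ q≈ ∘′ Λ⊆q)) }
    add-states Λ {suc k} f addable P⊆P₁ =
      let (P₂ , P₁▷*P₂ , in∈)  = add-states Λ (f ∘′ (inside ∷_)) addable P⊆P₁
          (P₃ , P₂▷*P₃ , out∈) = add-states Λ (f ∘′ (outside ∷_)) addable (▷*⇒⊆ P₁▷*P₂ ∘′ P⊆P₁)
      in P₃ , P₁▷*P₂ ◅◅ P₂▷*P₃ ,
         λ { q (true ∷ s) q≈ Λ⊆q  → ▷*⇒⊆ P₂▷*P₃ (in∈ q s q≈ Λ⊆q)
           ; q (false ∷ s) q≈ Λ⊆q → out∈ q s q≈ Λ⊆q }

    -- Nonemptiness is what makes `axiom` yield `εH`, and so carries the invariant through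
    -- `ax-rule`.
    Covered : Pred Sequent 0ℓ → Pred State 0ℓ → Set
    Covered 𝒮 P = ⟦ 𝒮 ⟧ ∩ NonEmpty ⊆ P

    -- Only an upper bound on the premise `Λ′` is assumed, so that one argument serves both modal
    -- rules.
    modal-addable : ∀ {𝒮 P Λ Λ′ Γ F} (π : Path (◇ F)) → Covered 𝒮 P →
                    Λ′ ∈ 𝒮 → ⌊ Λ′ ⌋ ⊆ Boxed Γ ∪ ｛ (_ , π ·◇) ｝ →
                    Λ ≈ ⌊ Γ ⌋ , π → Addable P Λ
    modal-addable {Λ′ = Λ′} {Γ} {F} π cov Λ′∈ Λ′⊆ (_ , ⇐) (Φ , _) Λ⊆Φ σ qs (_ , _ , succ)
      with strictlySurjective (F , π)
    -- The successor in direction `j` contains `π ·◇`, hence is nonempty as `Covered` requires, even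
    -- if the premise is empty.
    ... | j , refl = j , cov ((Λ′ , Λ′∈ , Λ′⊆qⱼ) , (_ , ◇∈qⱼ))
      where
      module E = _IsExpansionOf_ (succ j)

      π∈Φ : π ∈ₚ Φ
      π∈Φ = Λ⊆Φ (⇐ (inj₂ refl))

      ◇∈qⱼ : (π ·◇) ∈ₚ proj₁ (qs j)
      ◇∈qⱼ = E.extends (Ψ⁺ Φ π π∈Φ (inj₁ refl))

      Λ′⊆qⱼ : ⌊ Λ′ ⌋ ⊆ ⌊ proj₁ (qs j) ⌋
      Λ′⊆qⱼ = insert-⊆ (proj₁ (qs j)) Λ′⊆
        (λ { (boxed ρ ρ∈Γ) → E.extends (Ψ⁺ Φ π π∈Φ (inj₂ (boxed ρ (Λ⊆Φ (⇐ (inj₁ ρ∈Γ)))))) })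
        ◇∈qⱼ

    -- Only the modal rules lead from a state to its successors; the others compare sequents within
    -- one state, so no state has to be added.
    covered-or-addable : ∀ {𝒮 P Λ} → Covered 𝒮 P → 𝒮 infers Λ →
      (∀ q → ⌊ Λ ⌋ ⊆ ⌊ proj₁ q ⌋ → q ∈ NonEmpty → q ∈ P) ⊎ Addable P Λ
    covered-or-addable cov (∨-rule π Λₗ∈ (⇒ₗ , _) Λᵣ∈ (⇒ᵣ , _) (_ , ⇐)) =
      inj₁ λ (Φ , pe) Λ⊆Φ ne →
        [ (λ l∈ → cov ((_ , Λₗ∈ , insert-⊆ Φ ⇒ₗ (Λ⊆Φ ∘′ ⇐ ∘′ inj₁ ∘′ inj₁) l∈) , ne))
        , (λ r∈ → cov ((_ , Λᵣ∈ , insert-⊆ Φ ⇒ᵣ (Λ⊆Φ ∘′ ⇐ ∘′ inj₁ ∘′ inj₂) r∈) , ne))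
        ]′ (PropExpanded.∨-closed pe π (Λ⊆Φ (⇐ (inj₂ refl))))
    covered-or-addable cov (∧ₗ-rule π Λ′∈ (⇒ , _) (_ , ⇐)) =
      inj₁ λ (Φ , pe) Λ⊆Φ ne →
        let (l∈ , _) = PropExpanded.∧-closed pe π (Λ⊆Φ (⇐ (inj₂ refl)))
        in cov ((_ , Λ′∈ , insert-⊆ Φ ⇒ (Λ⊆Φ ∘′ ⇐ ∘′ inj₁) l∈) , ne)
    covered-or-addable cov (∧ᵣ-rule π Λ′∈ (⇒ , _) (_ , ⇐)) =
      inj₁ λ (Φ , pe) Λ⊆Φ ne →
        let (_ , r∈) = PropExpanded.∧-closed pe π (Λ⊆Φ (⇐ (inj₂ refl)))
        in cov ((_ , Λ′∈ , insert-⊆ Φ ⇒ (Λ⊆Φ ∘′ ⇐ ∘′ inj₁) r∈) , ne)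
    covered-or-addable cov (ax-rule Λ′∈ (⇒ , _)) =
      inj₁ λ (Φ , pe) Λ⊆Φ ne →
        cov ((_ , Λ′∈ , insert-⊆ Φ ⇒ Λ⊆Φ (PropExpanded.axiom pe ne)) , ne)
    covered-or-addable {𝒮} {P} cov (◇-rule π _ Λ′∈ (⇒ , _) Λ≈) =
      inj₂ (modal-addable {𝒮} {P} π cov Λ′∈ ⇒ Λ≈)
    covered-or-addable {𝒮} {P} cov (◇⁺-rule π _ Λ′∈ (⇒ , _) Λ≈) =
      inj₂ (modal-addable {𝒮} {P} π cov Λ′∈ (inj₁ ∘′ ⇒) Λ≈)

    ⊢*⇒▷* : ∀ {𝒮 𝒯 P} → 𝒮 ⊢ax* 𝒯 → Q₀ ▷* P → Covered 𝒮 P →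
            ∃[ Q ] (Q₀ ▷* Q × Covered 𝒯 Q)
    ⊢*⇒▷* {P = P} ε Q₀▷*P cov = P , Q₀▷*P , cov
    ⊢*⇒▷* {𝒮} {P = P} ((Λ , inf , ⇒ , _) ◅ 𝒮₁⊢*𝒯) Q₀▷*P cov
      with covered-or-addable cov inf
    ... | inj₁ covΛ = ⊢*⇒▷* 𝒮₁⊢*𝒯 Q₀▷*P λ { {q} ((Γ , Γ∈ , Γ⊆q) , ne) →
            [ (λ Γ∈𝒮 → cov ((Γ , Γ∈𝒮 , Γ⊆q) , ne))
            , (λ (Λ⊆Γ , _) → covΛ q (Γ⊆q ∘′ Λ⊆Γ) ne) ]′ (⇒ Γ∈) }
    ... | inj₂ addable =
      -- All codes are run through, and each state equals, up to `≈ₚ`, the decoding of its own code.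
      let (P′ , P▷*P′ , add) = add-states Λ decode addable id
      in ⊢*⇒▷* 𝒮₁⊢*𝒯 (Q₀▷*P ◅◅ P▷*P′) λ { {q} ((Γ , Γ∈ , Γ⊆q) , ne) →
            [ (λ Γ∈𝒮 → ▷*⇒⊆ P▷*P′ (cov ((Γ , Γ∈𝒮 , Γ⊆q) , ne)))
            , (λ (Λ⊆Γ , _) → add q (encode (proj₁ q)) (≐-sym (decode-encode (proj₁ q)))
                           (Γ⊆q ∘′ Λ⊆Γ)) ]′ (⇒ Γ∈) }

theorem4 : ∀ {G H : Formula} → NNF G → NNF H →
    let open PathCalculus G H in
    ∀ {n} (enum : Fin n ⤖ ◇Path) →
    let open EmptinessTest (formulaAutomaton enum) in
    ((Q : Pred QGH 0ℓ) → Q₀ ▷* Q →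
    ∃[ 𝒮 ] (𝒮₀ ⊢ax* 𝒮 × Q ⊆ ⟦ 𝒮 ⟧))
    ×
    ((𝒮 : Pred Sequent 0ℓ) → 𝒮₀ ⊢ax* 𝒮 →
    ∃[ Q ] (Q₀ ▷* Q × ⟦ 𝒮 ⟧ ∩ NonEmpty ⊆ Q))
theorem4 _ _ enum =
  (λ Q Q₀▷*Q → ▷*⇒⊢* enum Q₀▷*Q ε represents-𝒮₀? (λ {q} → Q₀⊆⟦𝒮₀⟧ enum {q})) ,
  (λ 𝒮 𝒮₀⊢*𝒮 → ⊢*⇒▷* enum 𝒮₀⊢*𝒮 ε
    -- A state containing an axiom has a clash and thus no transition, so it lies in `Q₀`.
    λ { {Φ , _} (rep , _) _ _ (_ , ¬clash , _) → ¬clash (represented⇒clash {Φ = Φ} rep) })
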